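{- Let $\Delta$ be a formal definition and $\mathcal{O}$ a context structure of $\Delta$. All safe-terminal natural inductions of $\Delta$ in $\mathcal{O}$ converge to the same structure, i.e., any two of them have the same limit.
   Context: Formal definitions. A formal definition $\Delta$ is a set of rules $\forall\bar x\,(P(\bar t)\leftarrow\phi)$ with $\phi$ a first-order formula and $P(\bar t)$ an atomic formula whose predicate $P$ is not equality. Such a rule is shorthand for $\forall\bar y\,(P(\bar y)\leftarrow\exists\bar x(\bar y=\bar t\wedge\phi))$, so every rule is assumed of the form $\forall\bar x\,(P(\bar x)\leftarrow\phi)$ with $\bar x$ distinct variables. $\mathrm{def}(\Delta)$ is the set of predicates occurring in heads; $\mathrm{pars}(\Delta)$ is the set of all other non-logical symbols with free occurrences in $\Delta$. A context structure $\mathcal{O}$ of $\Delta$ is a $\mathrm{pars}(\Delta)$-structure; let $D$ be its domain. A defined domain atom is $P(\bar a)$ with $P\in\mathrm{def}(\Delta)$ of arity $n$ and $\bar a\in D^n$; $\mathrm{At}$ is the set of all of them. $\mathrm{def}(\Delta)$-structures with domain $D$ are identified with subsets of $\mathrm{At}$ (the set of their true atoms). $\mathfrak{A}\vdash_\Delta P(\bar a)$ ("$P(\bar a)$ is derivable from $\mathfrak{A}$") means that some rule $\forall\bar x(P(\bar x)\leftarrow\phi)$ of $\Delta$ has $\phi$ true for $\bar x:=\bar a$ in the structure combining $\mathcal{O}$ and $\mathfrak{A}$. Natural inductions. A natural induction of $\Delta$ in $\mathcal{O}$ from $\mathfrak{A}$ is a $\subseteq$-increasing sequence $\mathcal{N}=(\mathfrak{A}_\alpha)_{0\le\alpha\le\beta}$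 ($\beta$ an ordinal) of subsets of $\mathrm{At}$ with $\mathfrak{A}_0=\mathfrak{A}$; $\mathfrak{A}_i\vdash_\Delta A$ for every $i+1\le\beta$ and every $A\in\mathfrak{A}_{i+1}\setminus\mathfrak{A}_i$; and $\mathfrak{A}_\lambda=\bigcup_{\alpha<\lambda}\mathfrak{A}_\alpha$ for limit ordinals $\lambda\le\beta$. Its limit is $\lim(\mathcal{N})=\mathfrak{A}_\beta$. A natural induction of $\Delta$ in $\mathcal{O}$ without further qualification starts from $\emptyset$. Safety. $A\in\mathrm{At}$ is safely derivable from $\mathfrak{A}$ if $\mathfrak{A}\vdash_\Delta A$ and $\lim(\mathcal{N})\vdash_\Delta A$ for each natural induction $\mathcal{N}$ of $\Delta$ in $\mathcal{O}$ from $\mathfrak{A}$. A natural induction is safe if for each $\alpha<\beta$ every atom of $\mathfrak{A}_{\alpha+1}\setminus\mathfrak{A}_\alpha$ is safely derivable from $\mathfrak{A}_\alpha$. It is safe-terminal if it is safe and every atom safely derivable from its limit belongs to its limit. -}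

module Defs where

open import Level using (Level) renaming (suc to lsuc)
open import Data.Nat.Base using (ℕ; suc)
open import Data.Fin.Base using (Fin)
open import Data.Vec.Base using (Vec; []; _∷_; lookup)
open import Data.Product.Base using (Σ-syntax; ∃-syntax; _×_; _,_)
open import Data.Sum.Base using (_⊎_; inj₁; inj₂)
open import Function.Base using (_∘_)
open import Induction.WellFounded using (WellFounded)
open import Relation.Nullary.Negation.Core using (¬_)
open import Relation.Nullary.Construct.Add.Supremum using (_⁺; ⊤⁺)
open import Relation.Binary.Core using (Rel)
open import Relation.Binary.Structures using (IsStrictTotalOrder)
open import Relation.Binary.PropositionalEquality.Core using (_≡_; refl)
open import Relation.Unary using (Pred; _∈_; _∉_; _⊆_; _≐_; _∪_; _∖_; ｛_｝)
open import Relation.Unary.Polymorphic using (∅)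
import Relation.Binary.Construct.Add.Supremum.Strict as Supremum

private
  variable
    ℓ : Level

------------------------------------------------------------------------
-- First-order logic

-- Equality is a logical symbol and so is not among the predicates.
-- Constants are functions of arity 0.

record Vocabulary (ℓ : Level) : Set (lsuc ℓ) where
  field
    Predicate : Set ℓ
    Function  : Set ℓ
    arityᵖ    : Predicate → ℕ
    arityᶠ    : Function → ℕ

module Syntax (V : Vocabulary ℓ) where
  open Vocabulary V public

  data Symbol : Set ℓ where
    pred : Predicate → Symbol
    func : Function → Symbol

  -- Variables are de Bruijn indices; n bounds the free ones.

  data Term (n : ℕ) : Set ℓ where
    var : Fin n → Term n
    app : (f : Function) → Vec (Term n) (arityᶠ f) → Term n

  infix  8 _≈_
  infixr 7 _∧_
  infixr 6 _∨_
  infixr 5 _⇒_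

  data Formula (n : ℕ) : Set ℓ where
    atom        : (P : Predicate) → Vec (Term n) (arityᵖ P) → Formula n
    _≈_         : Term n → Term n → Formula n
    neg         : Formula n → Formula n
    _∧_ _∨_ _⇒_ : Formula n → Formula n → Formula n
    all ex      : Formula (suc n) → Formula n

  mutual
    symbolsᵗ : ∀ {n} → Term n → Pred Symbol ℓ
    symbolsᵗ (var x)    = ∅
    symbolsᵗ (app f ts) = ｛ func f ｝ ∪ symbolsᵗˢ ts

    symbolsᵗˢ : ∀ {n k} → Vec (Term n) k → Pred Symbol ℓ
    symbolsᵗˢ []       = ∅
    symbolsᵗˢ (t ∷ ts) = symbolsᵗ t ∪ symbolsᵗˢ ts

  symbols : ∀ {n} → Formula n → Pred Symbol ℓ
  symbols (atom P ts) = ｛ pred P ｝ ∪ symbolsᵗˢ ts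
  symbols (t ≈ u)     = symbolsᵗ t ∪ symbolsᵗ u
  symbols (neg φ)     = symbols φ
  symbols (φ ∧ ψ)     = symbols φ ∪ symbols ψ
  symbols (φ ∨ ψ)     = symbols φ ∪ symbols ψ
  symbols (φ ⇒ ψ)     = symbols φ ∪ symbols ψ
  symbols (all φ)     = symbols φ
  symbols (ex φ)      = symbols φ

  -- A structure interpreting exactly the symbols in S.  Membership in S is
  -- irrelevant, so each symbol of S has a single interpretation.

  record Structure (S : Pred Symbol ℓ) : Set (lsuc ℓ) where
    field
      Domain   : Set ℓ
      function : (f : Function) → .(func f ∈ S) →
                 Vec Domain (arityᶠ f) → Domain
      relation : (P : Predicate) → .(pred P ∈ S) →
                 Pred (Vec Domain (arityᵖ P)) ℓ

  module Semantics {S : Pred Symbol ℓ} (𝔐 : Structure S) where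
    open Structure 𝔐

    mutual
      ⟦_⟧ᵗ : ∀ {n} (t : Term n) → symbolsᵗ t ⊆ S → Vec Domain n → Domain
      ⟦ var x ⟧ᵗ    s ρ = lookup ρ x
      ⟦ app f ts ⟧ᵗ s ρ =
        function f (s (inj₁ refl)) (⟦ ts ⟧ᵗˢ (s ∘ inj₂) ρ)

      ⟦_⟧ᵗˢ : ∀ {n k} (ts : Vec (Term n) k) → symbolsᵗˢ ts ⊆ S →
              Vec Domain n → Vec Domain k
      ⟦ [] ⟧ᵗˢ     s ρ = []
      ⟦ t ∷ ts ⟧ᵗˢ s ρ = ⟦ t ⟧ᵗ (s ∘ inj₁) ρ ∷ ⟦ ts ⟧ᵗˢ (s ∘ inj₂) ρ

    ⟦_⟧ : ∀ {n} (φ : Formula n) → symbols φ ⊆ S → Pred (Vec Domain n) ℓ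
    ⟦ atom P ts ⟧ s ρ = relation P (s (inj₁ refl)) (⟦ ts ⟧ᵗˢ (s ∘ inj₂) ρ)
    ⟦ t ≈ u ⟧     s ρ = ⟦ t ⟧ᵗ (s ∘ inj₁) ρ ≡ ⟦ u ⟧ᵗ (s ∘ inj₂) ρ
    ⟦ neg φ ⟧     s ρ = ¬ ⟦ φ ⟧ s ρ
    ⟦ φ ∧ ψ ⟧     s ρ = ⟦ φ ⟧ (s ∘ inj₁) ρ × ⟦ ψ ⟧ (s ∘ inj₂) ρ
    ⟦ φ ∨ ψ ⟧     s ρ = ⟦ φ ⟧ (s ∘ inj₁) ρ ⊎ ⟦ ψ ⟧ (s ∘ inj₂) ρ
    ⟦ φ ⇒ ψ ⟧     s ρ = ⟦ φ ⟧ (s ∘ inj₁) ρ → ⟦ ψ ⟧ (s ∘ inj₂) ρ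
    ⟦ all φ ⟧     s ρ = ∀ d → ⟦ φ ⟧ s (d ∷ ρ)
    ⟦ ex φ ⟧      s ρ = ∃[ d ] ⟦ φ ⟧ s (d ∷ ρ)

------------------------------------------------------------------------
-- Formal definitions

  -- The rule ∀x̄ (P(x̄) ← φ) with x̄ distinct variables: the free variables
  -- of φ are among x̄, and x̄ are the indices below the arity of P.

  record Rule : Set ℓ where
    field
      head : Predicate
      body : Formula (arityᵖ head)

  open Rule public

  FormalDefinition : Set (lsuc ℓ)
  FormalDefinition = Pred Rule ℓ

  module _ (Δ : FormalDefinition) where

    def : Pred Symbol ℓ
    def s = ∃[ r ] r ∈ Δ × s ≡ pred (head r)

    inBodies : Pred Symbol ℓ
    inBodies s = ∃[ r ] r ∈ Δ × s ∈ symbols (body r)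

    pars : Pred Symbol ℓ
    pars = inBodies ∖ def

    ContextStructure : Set (lsuc ℓ)
    ContextStructure = Structure pars

------------------------------------------------------------------------
-- Ordinals

-- A classical ordinal, as a well-ordered set: that of its predecessors.

record Ordinal (ℓ : Level) : Set (lsuc ℓ) where
  field
    Carrier            : Set ℓ
    _<_                : Rel Carrier ℓ
    isStrictTotalOrder : IsStrictTotalOrder _≡_ _<_
    wellFounded        : WellFounded _<_

-- Adjoining a supremum to the set of all α < β gives the set of all α ≤ β.

module UpTo (β : Ordinal ℓ) where
  open Ordinal β using (Carrier; _<_)
  open Supremum _<_ public using (_<⁺_)

  Index : Set ℓ
  Index = Carrier ⁺

  IsZero : Pred Index ℓ
  IsZero α = ∀ γ → ¬ (γ <⁺ α)

  _IsSuccessorOf_ : Rel Index ℓ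
  γ IsSuccessorOf α = α <⁺ γ × (∀ δ → ¬ (α <⁺ δ × δ <⁺ γ))

  IsLimit : Pred Index ℓ
  IsLimit α = ¬ IsZero α × ¬ (∃[ γ ] α IsSuccessorOf γ)

------------------------------------------------------------------------
-- Natural inductions

module Induction (V : Vocabulary ℓ) (Δ : Syntax.FormalDefinition V)
                 (𝒪 : Syntax.ContextStructure V Δ) where
  open Syntax V
  open Structure 𝒪 using (Domain; function; relation)

  -- The irrelevant field keeps atoms from being distinguished by which rule
  -- witnesses that their predicate is defined.

  record At : Set ℓ where
    constructor _[_]⟨_⟩
    field
      predicate  : Predicate
      .isDefined : pred predicate ∈ def Δ
      arguments  : Vec Domain (arityᵖ predicate)

  open At public

  vocabulary : Pred Symbol ℓ
  vocabulary = def Δ ∪ inBodies Δ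

  func∈pars : ∀ {f} → func f ∈ vocabulary → func f ∈ pars Δ
  func∈pars (inj₁ (_ , _ , ()))
  func∈pars (inj₂ f∈)           = f∈ , λ { (_ , _ , ()) }

  -- The structure combining 𝒪 and 𝔄.  As def Δ and pars Δ are disjoint, at
  -- most one summand of the interpretation of a predicate is inhabited.

  combine : Pred At ℓ → Structure vocabulary
  combine 𝔄 = record
    { Domain   = Domain
    ; function = λ f f∈ → function f (func∈pars f∈)
    ; relation = λ P _ ā →
        (Σ[ d ∈ pred P ∈ def Δ ]  P [ d ]⟨ ā ⟩ ∈ 𝔄) ⊎
        (Σ[ p ∈ pred P ∈ pars Δ ] ā ∈ relation P p)
    }

  infix 4 _⊢_

  data _⊢_ (𝔄 : Pred At ℓ) : Pred At ℓ where
    derive : ∀ {r ā} .{d} (r∈Δ : r ∈ Δ) →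
             Semantics.⟦_⟧ (combine 𝔄) (body r)
               (λ s∈ → inj₂ (r , r∈Δ , s∈)) ā →
             𝔄 ⊢ head r [ d ]⟨ ā ⟩

  record NaturalInduction (𝔄 : Pred At ℓ) : Set (lsuc ℓ) where
    field
      length : Ordinal ℓ
    open UpTo length public
    field
      stage      : Index → Pred At ℓ
      increasing : ∀ {α γ} → α <⁺ γ → stage α ⊆ stage γ
      initial    : ∀ {α} → IsZero α → stage α ≐ 𝔄
      successor  : ∀ {α γ} → γ IsSuccessorOf α →
                   ∀ {A} → A ∈ stage γ ∖ stage α → stage α ⊢ A
      limit      : ∀ {α} → IsLimit α →
                   stage α ≐ λ A → ∃[ γ ] γ <⁺ α × A ∈ stage γ

  lim : ∀ {𝔄} → NaturalInduction 𝔄 → Pred At ℓ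
  lim 𝒩 = NaturalInduction.stage 𝒩 ⊤⁺

  SafelyDerivable : Pred At ℓ → Pred At (lsuc ℓ)
  SafelyDerivable 𝔄 A = 𝔄 ⊢ A × (∀ (𝒩 : NaturalInduction 𝔄) → lim 𝒩 ⊢ A)

  Safe : ∀ {𝔄} → Pred (NaturalInduction 𝔄) (lsuc ℓ)
  Safe 𝒩 = ∀ {α γ} → γ IsSuccessorOf α →
           ∀ {A} → A ∈ stage γ ∖ stage α → SafelyDerivable (stage α) A
    where open NaturalInduction 𝒩

  SafeTerminal : ∀ {𝔄} → Pred (NaturalInduction 𝔄) (lsuc ℓ)
  SafeTerminal 𝒩 = Safe 𝒩 × SafelyDerivable (lim 𝒩) ⊆ lim 𝒩

{-# OPTIONS --safe #-}
module Submission where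

-- The proof is a confluence argument for safe natural inductions 𝒩 and ℳ
-- from a common set 𝔄.
--
-- Let A be an atom that 𝒩 adds to its stage 𝒩_α.  Then A is safely derivable
-- from 𝒩_α, so it is derivable from the limit of every natural induction from
-- 𝒩_α.  One such induction is (𝒩_α ∪ ℳ_δ) for δ ≤ β (`adjoin`), as long as
-- every atom that ℳ adds to ℳ_δ, for δ < β, is derivable from 𝒩_α ∪ ℳ_δ.  That
-- condition is the claim "A is derivable from 𝒩_α ∪ ℳ_β" with 𝒩 and ℳ
-- exchanged and β replaced by the smaller δ.  Hence the claim holds for all
-- α and β by well-founded induction (`additions-persist`).
--
-- Now let ℳ also be safe-terminal with limit M.  By induction on α, every
-- stage 𝒩_α is included in M.  The essential case is that of an atom A added
-- to some 𝒩_α ⊆ M.  By the above there is a natural induction from 𝒩_α to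
-- 𝒩_α ∪ M = M.  Any natural induction from M can be appended to it
-- (`concatenate`), and the result is a natural induction from 𝒩_α, whose limit
-- derives A.  So A is safely derivable from M, whence A ∈ M by terminality
-- (`stage⊆limit-of-terminal`).  The theorem follows by symmetry.

open import Defs
open import Level using (Level)
open import Axiom.ExcludedMiddle using (ExcludedMiddle)
open import Data.Product.Base using (∃-syntax; _×_; _,_; proj₁; proj₂)
import Data.Product.Base as Product
open import Data.Sum.Base using (_⊎_; inj₁; inj₂)
import Data.Sum.Base as Sum
open import Data.Sum.Relation.Binary.LeftOrder
  using (_⊎-<_; ₁∼₂; ₁∼₁; ₂∼₂; ⊎-<-transitive; ⊎-<-trichotomous; ⊎-<-wellFounded)
open import Data.Sum.Relation.Binary.Pointwise using (Pointwise-≡⇒≡; ≡⇒Pointwise-≡)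
open import Data.Vec.Base using (Vec; []; _∷_)
open import Function.Base using (id; _∘_)
open import Induction.WellFounded using (Acc; acc; WellFounded)
open import Relation.Binary.Definitions using (Trichotomous; tri<; tri≈; tri>)
open import Relation.Binary.PropositionalEquality
  using (_≡_; refl; sym; trans; cong; cong₂; subst; isEquivalence)
open import Relation.Binary.Structures using (IsStrictTotalOrder)
open import Relation.Binary.Structures.Biased using (isStrictTotalOrderᶜ)
open import Relation.Nullary.Construct.Add.Supremum using (⊤⁺; [_])
open import Relation.Nullary.Decidable.Core using (yes; no)
open import Relation.Nullary.Negation.Core using (¬_; contradiction)
open import Relation.Unary using (Pred; _∈_; _⊆_; _≐_; _∪_; _∩_; _∖_)
open import Relation.Unary.Polymorphic using (∅)
open import Relation.Unary.Properties using (≐-sym; ≐-trans)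
import Relation.Binary.Construct.Add.Supremum.Strict as Supremum

private
  variable
    ℓ : Level

-- Ordinals

module _ (β : Ordinal ℓ) where
  open Ordinal β
  open UpTo β

  <⁺-isStrictTotalOrder : IsStrictTotalOrder _≡_ _<⁺_
  <⁺-isStrictTotalOrder = Supremum.<⁺-isStrictTotalOrder-≡ _<_ isStrictTotalOrder

  <⁺-accessible : ∀ {k} → Acc _<_ k → Acc _<⁺_ [ k ]
  <⁺-accessible (acc rs) = acc λ { Supremum.[ p ] → <⁺-accessible (rs p) }

  <⁺-wellFounded : WellFounded _<⁺_
  <⁺-wellFounded [ k ] = <⁺-accessible (wellFounded k)
  <⁺-wellFounded ⊤⁺    = acc λ { Supremum.[ k ]<⊤⁺ → <⁺-accessible (wellFounded k) }

  nonzero⇒above : ExcludedMiddle ℓ → ∀ {α} → ¬ IsZero α → ∃[ γ ] γ <⁺ α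
  nonzero⇒above em ¬zero with em
  ... | yes above = above
  ... | no ¬above = contradiction (λ γ γ<α → ¬above (γ , γ<α)) ¬zero

-- The ordinal (β₁ + 1) + β₂.  The ordinals up to and including it are a copy
-- of {α : α ≤ β₁} followed by a copy of {α : α ≤ β₂}.

_+1+_ : Ordinal ℓ → Ordinal ℓ → Ordinal ℓ
β₁ +1+ β₂ = record
  { Carrier            = B₁.Index ⊎ O₂.Carrier
  ; _<_                = B₁._<⁺_ ⊎-< O₂._<_
  ; isStrictTotalOrder = isStrictTotalOrderᶜ record
      { isEquivalence = isEquivalence
      ; trans         = ⊎-<-transitive S₁.trans S₂.trans
      ; compare       = compare
      }
  ; wellFounded        = ⊎-<-wellFounded (<⁺-wellFounded β₁) O₂.wellFounded
  }
  where
  module B₁ = UpTo β₁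
  module O₂ = Ordinal β₂
  module S₁ = IsStrictTotalOrder (<⁺-isStrictTotalOrder β₁)
  module S₂ = IsStrictTotalOrder O₂.isStrictTotalOrder

  compare : Trichotomous _≡_ (B₁._<⁺_ ⊎-< O₂._<_)
  compare x y with ⊎-<-trichotomous S₁.compare S₂.compare x y
  ... | tri< x<y x≉y x≯y = tri< x<y (x≉y ∘ ≡⇒Pointwise-≡) x≯y
  ... | tri≈ x≮y x≈y x≯y = tri≈ x≮y (Pointwise-≡⇒≡ x≈y) x≯y
  ... | tri> x≮y x≉y x>y = tri> x≮y (x≉y ∘ ≡⇒Pointwise-≡) x>y

module Sum+1 (β₁ β₂ : Ordinal ℓ) where
  private
    module B₁ = UpTo β₁
    module B₂ = UpTo β₂
  open UpTo (β₁ +1+ β₂)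

  -- The copies of the two index sets.  The top of the first is an index of its
  -- own, whose successor is the least element of the second copy.

  left : B₁.Index → Index
  left i = [ inj₁ i ]

  right : B₂.Index → Index
  right [ c ] = [ inj₂ c ]
  right ⊤⁺    = ⊤⁺

  -- Every index lies in exactly one of the two copies.

  data Side : Index → Set ℓ where
    onLeft  : ∀ i → Side (left i)
    onRight : ∀ j → Side (right j)

  side : ∀ α → Side α
  side [ inj₁ i ] = onLeft i
  side [ inj₂ c ] = onRight [ c ]
  side ⊤⁺         = onRight ⊤⁺

  left-mono : ∀ {i i′} → i B₁.<⁺ i′ → left i <⁺ left i′
  left-mono p = Supremum.[ ₁∼₁ p ]

  left-cancel : ∀ {i i′} → left i <⁺ left i′ → i B₁.<⁺ i′
  left-cancel Supremum.[ ₁∼₁ p ] = p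

  right-mono : ∀ {j j′} → j B₂.<⁺ j′ → right j <⁺ right j′
  right-mono Supremum.[ p ]    = Supremum.[ ₂∼₂ p ]
  right-mono Supremum.[ k ]<⊤⁺ = Supremum.[ inj₂ k ]<⊤⁺

  right-cancel : ∀ {j j′} → right j <⁺ right j′ → j B₂.<⁺ j′
  right-cancel {[ _ ]} {[ _ ]} Supremum.[ ₂∼₂ p ] = Supremum.[ p ]
  right-cancel {[ k ]} {⊤⁺}    _                  = Supremum.[ k ]<⊤⁺
  right-cancel {⊤⁺}    {[ _ ]} ()
  right-cancel {⊤⁺}    {⊤⁺}    ()

  left<right : ∀ i j → left i <⁺ right j
  left<right i [ c ] = Supremum.[ ₁∼₂ ]
  left<right i ⊤⁺    = Supremum.[ inj₁ i ]<⊤⁺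

  right≮left : ∀ {i} j → ¬ (right j <⁺ left i)
  right≮left [ c ] Supremum.[ () ]
  right≮left ⊤⁺    ()

  left-zero : ∀ {i} → B₁.IsZero i → IsZero (left i)
  left-zero i-zero γ γ<i with side γ
  ... | onLeft k  = i-zero k (left-cancel γ<i)
  ... | onRight k = right≮left k γ<i

  left-zero⁻ : ∀ {i} → IsZero (left i) → B₁.IsZero i
  left-zero⁻ i-zero k k<i = i-zero (left k) (left-mono k<i)

  right-nonzero : ∀ j → ¬ IsZero (right j)
  right-nonzero j j-zero = j-zero (left ⊤⁺) (left<right ⊤⁺ j)

  left-successor : ∀ {i i′} → i′ B₁.IsSuccessorOf i → left i′ IsSuccessorOf left i
  left-successor {i} {i′} (i<i′ , adjacent) = left-mono i<i′ , adjacent′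
    where
    adjacent′ : ∀ δ → ¬ (left i <⁺ δ × δ <⁺ left i′)
    adjacent′ δ (i<δ , δ<i′) with side δ
    ... | onLeft k  = adjacent k (left-cancel i<δ , left-cancel δ<i′)
    ... | onRight k = right≮left k δ<i′

  left-successor⁻ : ∀ {i i′} → left i′ IsSuccessorOf left i → i′ B₁.IsSuccessorOf i
  left-successor⁻ (i<i′ , adjacent) =
    left-cancel i<i′ , λ k (i<k , k<i′) → adjacent (left k) (left-mono i<k , left-mono k<i′)

  right-successor : ∀ {j j′} → j′ B₂.IsSuccessorOf j → right j′ IsSuccessorOf right j
  right-successor {j} {j′} (j<j′ , adjacent) = right-mono j<j′ , adjacent′
    where
    adjacent′ : ∀ δ → ¬ (right j <⁺ δ × δ <⁺ right j′)
    adjacent′ δ (j<δ , δ<j′) with side δ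
    ... | onLeft k  = right≮left j j<δ
    ... | onRight k = adjacent k (right-cancel j<δ , right-cancel δ<j′)

  right-successor⁻ : ∀ {j j′} → right j′ IsSuccessorOf right j → j′ B₂.IsSuccessorOf j
  right-successor⁻ (j<j′ , adjacent) =
    right-cancel j<j′ , λ k (j<k , k<j′) → adjacent (right k) (right-mono j<k , right-mono k<j′)

  zero-succeeds-⊤ : ∀ {j} → B₂.IsZero j → right j IsSuccessorOf left ⊤⁺
  zero-succeeds-⊤ {j} j-zero = left<right ⊤⁺ j , adjacent
    where
    adjacent : ∀ δ → ¬ (left ⊤⁺ <⁺ δ × δ <⁺ right j)
    adjacent δ (⊤<δ , δ<j) with side δ
    ... | onLeft k  with () ← left-cancel ⊤<δ
    ... | onRight k = j-zero k (right-cancel δ<j)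

  right-succeeds-left⁻ : ∀ {i j} → right j IsSuccessorOf left i → i ≡ ⊤⁺ × B₂.IsZero j
  right-succeeds-left⁻ {i} {j} (_ , adjacent) = is-⊤ i refl , λ k k<j →
    adjacent (right k) (left<right i k , right-mono k<j)
    where
    is-⊤ : ∀ k → k ≡ i → i ≡ ⊤⁺
    is-⊤ ⊤⁺    refl = refl
    is-⊤ [ k ] refl =
      contradiction (left-mono Supremum.[ k ]<⊤⁺ , left<right ⊤⁺ j) (adjacent (left ⊤⁺))

  left-limit⁻ : ∀ {i} → IsLimit (left i) → B₁.IsLimit i
  left-limit⁻ (nonzero , nonsuccessor) =
    nonzero ∘ left-zero , λ (k , suc) → nonsuccessor (left k , left-successor suc)

  right-limit⁻ : ∀ {j} → IsLimit (right j) → B₂.IsLimit j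
  right-limit⁻ (_ , nonsuccessor) =
    (λ j-zero → nonsuccessor (left ⊤⁺ , zero-succeeds-⊤ j-zero)) ,
    λ (k , suc) → nonsuccessor (right k , right-successor suc)

module _ (V : Vocabulary ℓ) (Δ : Syntax.FormalDefinition V)
         (𝒪 : Syntax.ContextStructure V Δ) where
  open Syntax V
  open Induction V Δ 𝒪

  private
    variable
      𝔄 𝔅 : Pred At ℓ

-- Derivability depends only on the extension of a set of atoms

  module _ (𝔄 𝔅 : Pred At ℓ) where
    private
      module A = Semantics (combine 𝔄)
      module B = Semantics (combine 𝔅)

    mutual
      ⟦⟧ᵗ-independent : ∀ {n} (t : Term n) (s : symbolsᵗ t ⊆ vocabulary) ρ →
                        A.⟦ t ⟧ᵗ s ρ ≡ B.⟦ t ⟧ᵗ s ρ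
      ⟦⟧ᵗ-independent (var x)    s ρ = refl
      ⟦⟧ᵗ-independent (app f ts) s ρ = cong (Structure.function 𝒪 f _)
        (⟦⟧ᵗˢ-independent ts (s ∘ inj₂) ρ)

      ⟦⟧ᵗˢ-independent : ∀ {n k} (ts : Vec (Term n) k) (s : symbolsᵗˢ ts ⊆ vocabulary) ρ →
                         A.⟦ ts ⟧ᵗˢ s ρ ≡ B.⟦ ts ⟧ᵗˢ s ρ
      ⟦⟧ᵗˢ-independent []       s ρ = refl
      ⟦⟧ᵗˢ-independent (t ∷ ts) s ρ =
        cong₂ _∷_ (⟦⟧ᵗ-independent t (s ∘ inj₁) ρ) (⟦⟧ᵗˢ-independent ts (s ∘ inj₂) ρ)

  -- Both inclusions are needed, since negations and implications exchange the
  -- roles of 𝔄 and 𝔅.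

  ⟦⟧-resp-≐ : 𝔄 ≐ 𝔅 → ∀ {n} (φ : Formula n) (s : symbols φ ⊆ vocabulary) ρ →
              Semantics.⟦_⟧ (combine 𝔄) φ s ρ → Semantics.⟦_⟧ (combine 𝔅) φ s ρ
  ⟦⟧-resp-≐ {𝔄} {𝔅} (𝔄⊆𝔅 , 𝔅⊆𝔄) (atom P ts) s ρ =
    subst (Structure.relation (combine 𝔅) P (s (inj₁ refl)))
      (⟦⟧ᵗˢ-independent 𝔄 𝔅 ts (s ∘ inj₂) ρ)
    ∘ Sum.map₁ (Product.map₂ 𝔄⊆𝔅)
  ⟦⟧-resp-≐ {𝔄} {𝔅} _ (t ≈ u) s ρ t≡u =
    trans (sym (⟦⟧ᵗ-independent 𝔄 𝔅 t (s ∘ inj₁) ρ))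
      (trans t≡u (⟦⟧ᵗ-independent 𝔄 𝔅 u (s ∘ inj₂) ρ))
  ⟦⟧-resp-≐ e (neg φ) s ρ ¬h = ¬h ∘ ⟦⟧-resp-≐ (≐-sym e) φ s ρ
  ⟦⟧-resp-≐ e (φ ∧ ψ) s ρ =
    Product.map (⟦⟧-resp-≐ e φ (s ∘ inj₁) ρ) (⟦⟧-resp-≐ e ψ (s ∘ inj₂) ρ)
  ⟦⟧-resp-≐ e (φ ∨ ψ) s ρ =
    Sum.map (⟦⟧-resp-≐ e φ (s ∘ inj₁) ρ) (⟦⟧-resp-≐ e ψ (s ∘ inj₂) ρ)
  ⟦⟧-resp-≐ e (φ ⇒ ψ) s ρ h =
    ⟦⟧-resp-≐ e ψ (s ∘ inj₂) ρ ∘ h ∘ ⟦⟧-resp-≐ (≐-sym e) φ (s ∘ inj₁) ρ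
  ⟦⟧-resp-≐ e (all φ) s ρ h d = ⟦⟧-resp-≐ e φ s (d ∷ ρ) (h d)
  ⟦⟧-resp-≐ e (ex φ)  s ρ (d , h) = d , ⟦⟧-resp-≐ e φ s (d ∷ ρ) h

  ⊢-resp-≐ : 𝔄 ≐ 𝔅 → ∀ {A} → 𝔄 ⊢ A → 𝔅 ⊢ A
  ⊢-resp-≐ e (derive {r} r∈Δ h) = derive r∈Δ (⟦⟧-resp-≐ e (body r) _ _ h)

-- Constructions on natural inductions

  stage⊆lim : (𝒩 : NaturalInduction 𝔄) → ∀ α → NaturalInduction.stage 𝒩 α ⊆ lim 𝒩
  stage⊆lim 𝒩 ⊤⁺    = id
  stage⊆lim 𝒩 [ k ] = NaturalInduction.increasing 𝒩 Supremum.[ k ]<⊤⁺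

  -- Every atom that ℳ adds to a stage ℳ_δ with δ < β is derivable from 𝔅 ∪ ℳ_δ.

  AdditionsDerivableWith : Pred At ℓ → (ℳ : NaturalInduction 𝔄) →
                           NaturalInduction.Index ℳ → Set ℓ
  AdditionsDerivableWith 𝔅 ℳ β =
    ∀ {δ δ′} → δ <⁺ β → δ′ IsSuccessorOf δ →
    ∀ {A} → A ∈ stage δ′ ∖ stage δ → 𝔅 ∪ stage δ ⊢ A
    where open NaturalInduction ℳ

  module _ (em : ExcludedMiddle ℓ) where

    start⊆stage : (𝒩 : NaturalInduction 𝔄) → ∀ α → 𝔄 ⊆ NaturalInduction.stage 𝒩 α
    start⊆stage {𝔄} 𝒩 α = go (<⁺-wellFounded length α)
      where
      open NaturalInduction 𝒩
      go : ∀ {α} → Acc _<⁺_ α → 𝔄 ⊆ stage α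
      go {α} (acc rs) with em {P = IsZero α}
      ... | yes zero = proj₂ (initial zero)
      ... | no ¬zero with γ , γ<α ← nonzero⇒above length em ¬zero =
        increasing γ<α ∘ go (rs γ<α)

    -- The concatenation of a natural induction from 𝔄 to 𝔅 and one from 𝔅.
    -- Its length is (β₁ + 1) + β₂, so 𝔅 is repeated, as the last stage of the
    -- first part and as the initial stage of the second.  The step between the
    -- two copies adds no atom.

    module _ (𝒩 : NaturalInduction 𝔄) (𝒦 : NaturalInduction 𝔅)
             (𝒩→𝔅 : lim 𝒩 ≐ 𝔅) where
      private
        module N = NaturalInduction 𝒩
        module K = NaturalInduction 𝒦
      open Sum+1 N.length K.length
      open UpTo (N.length +1+ K.length)

      private
        stage⁺ : Index → Pred At ℓ
        stage⁺ [ inj₁ i ] = N.stage i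
        stage⁺ [ inj₂ c ] = K.stage [ c ]
        stage⁺ ⊤⁺         = K.stage ⊤⁺

        stage⁺-right : ∀ j → stage⁺ (right j) ≡ K.stage j
        stage⁺-right [ c ] = refl
        stage⁺-right ⊤⁺    = refl

        increasing⁺ : ∀ {α γ} → α <⁺ γ → stage⁺ α ⊆ stage⁺ γ
        increasing⁺ {α} {γ} α<γ with side α | side γ
        ... | onLeft i  | onLeft i′  = N.increasing (left-cancel α<γ)
        ... | onLeft i  | onRight j  rewrite stage⁺-right j =
          start⊆stage 𝒦 j ∘ proj₁ 𝒩→𝔅 ∘ stage⊆lim 𝒩 i
        ... | onRight j | onLeft i   = contradiction α<γ (right≮left j)
        ... | onRight j | onRight j′ rewrite stage⁺-right j | stage⁺-right j′ =
          K.increasing (right-cancel α<γ)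

        initial⁺ : ∀ {α} → IsZero α → stage⁺ α ≐ 𝔄
        initial⁺ {α} α-zero with side α
        ... | onLeft i  = N.initial (left-zero⁻ α-zero)
        ... | onRight j = contradiction α-zero (right-nonzero j)

        successor⁺ : ∀ {α γ} → γ IsSuccessorOf α →
                     ∀ {A} → A ∈ stage⁺ γ ∖ stage⁺ α → stage⁺ α ⊢ A
        successor⁺ {α} {γ} suc A∈ with side α | side γ
        ... | onLeft i  | onLeft i′  = N.successor (left-successor⁻ suc) A∈
        ... | onRight j | onLeft i   = contradiction (proj₁ suc) (right≮left j)
        ... | onRight j | onRight j′ rewrite stage⁺-right j | stage⁺-right j′ =
          K.successor (right-successor⁻ suc) A∈
        ... | onLeft i  | onRight j  rewrite stage⁺-right j
          with refl , j-zero ← right-succeeds-left⁻ suc =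
          contradiction (proj₂ 𝒩→𝔅 (proj₁ (K.initial j-zero) (proj₁ A∈))) (proj₂ A∈)

        limit⁺ : ∀ {α} → IsLimit α →
                 stage⁺ α ≐ λ A → ∃[ γ ] γ <⁺ α × A ∈ stage⁺ γ
        limit⁺ {α} α-limit = covered , λ (_ , γ<α , A∈) → increasing⁺ γ<α A∈
          where
          covered : stage⁺ α ⊆ λ A → ∃[ γ ] γ <⁺ α × A ∈ stage⁺ γ
          covered {A} A∈ with side α
          ... | onLeft i
            with k , k<i , A∈k ← proj₁ (N.limit (left-limit⁻ α-limit)) A∈ =
            left k , left-mono k<i , A∈k
          ... | onRight j
            with k , k<j , A∈k ← proj₁ (K.limit (right-limit⁻ α-limit))
                                   (subst (A ∈_) (stage⁺-right j) A∈) =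
            right k , right-mono k<j , subst (A ∈_) (sym (stage⁺-right k)) A∈k

      concatenate : NaturalInduction 𝔄
      concatenate = record
        { length     = N.length +1+ K.length
        ; stage      = stage⁺
        ; increasing = increasing⁺
        ; initial    = initial⁺
        ; successor  = successor⁺
        ; limit      = limit⁺
        }

    -- The natural induction (𝔅 ∪ ℳ_δ)_{δ ≤ β} from 𝔅 ⊇ 𝔄, for ℳ a natural
    -- induction from 𝔄.  Rather than truncating the length of ℳ at β, the
    -- stages are made constant from β on, as 𝔅 ∪ (ℳ_δ ∩ ℳ_β).  Derivability is
    -- not monotone, so the hypothesis `derivable` does not follow from ℳ being
    -- a natural induction.

    module _ (ℳ : NaturalInduction 𝔄) (β : NaturalInduction.Index ℳ)
             (𝔄⊆𝔅 : 𝔄 ⊆ 𝔅)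
             (derivable : AdditionsDerivableWith 𝔅 ℳ β) where
      open NaturalInduction ℳ
      open IsStrictTotalOrder (<⁺-isStrictTotalOrder length) using (compare)

      adjoin : NaturalInduction 𝔅
      adjoin = record
        { length     = length
        ; stage      = λ δ → 𝔅 ∪ (stage δ ∩ stage β)
        ; increasing = λ α<γ → Sum.map₂ (Product.map₁ (increasing α<γ))
        ; initial    = λ zero → Sum.[ id , 𝔄⊆𝔅 ∘ proj₁ (initial zero) ∘ proj₁ ] , inj₁
        ; successor  = successor′
        ; limit      = limit′
        }
        where
        successor′ : ∀ {α γ} → γ IsSuccessorOf α →
                     ∀ {A} → A ∈ (𝔅 ∪ (stage γ ∩ stage β)) ∖ (𝔅 ∪ (stage α ∩ stage β)) →
                     𝔅 ∪ (stage α ∩ stage β) ⊢ A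
        successor′ suc (inj₁ A∈𝔅 , A∉) = contradiction (inj₁ A∈𝔅) A∉
        successor′ {α} suc (inj₂ (A∈γ , A∈β) , A∉) with compare α β
        ... | tri< α<β _ _ =
          ⊢-resp-≐ (Sum.map₂ (λ A∈α → A∈α , increasing α<β A∈α) , Sum.map₂ proj₁)
            (derivable α<β suc (A∈γ , λ A∈α → A∉ (inj₂ (A∈α , A∈β))))
        ... | tri≈ _ refl _ = contradiction (inj₂ (A∈β , A∈β)) A∉
        ... | tri> _ _ β<α  = contradiction (inj₂ (increasing β<α A∈β , A∈β)) A∉

        limit′ : ∀ {α} → IsLimit α → (𝔅 ∪ (stage α ∩ stage β)) ≐
                 λ A → ∃[ γ ] γ <⁺ α × A ∈ 𝔅 ∪ (stage γ ∩ stage β)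
        limit′ {α} α-limit = covered ,
          λ (_ , γ<α , A∈) → Sum.map₂ (Product.map₁ (increasing γ<α)) A∈
          where
          covered : 𝔅 ∪ (stage α ∩ stage β) ⊆
                    λ A → ∃[ γ ] γ <⁺ α × A ∈ 𝔅 ∪ (stage γ ∩ stage β)
          -- An atom of 𝔅 lies in every stage, and α has some index below it.
          covered (inj₁ A∈𝔅) with γ , γ<α ← nonzero⇒above length em (proj₁ α-limit) =
            γ , γ<α , inj₁ A∈𝔅
          covered (inj₂ (A∈α , A∈β)) with γ , γ<α , A∈γ ← proj₁ (limit α-limit) A∈α =
            γ , γ<α , inj₂ (A∈γ , A∈β)

      lim-adjoin : lim adjoin ≐ 𝔅 ∪ stage β
      lim-adjoin = Sum.map₂ proj₂ , Sum.map₂ λ A∈β → stage⊆lim ℳ β A∈β , A∈β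

-- Confluence of safe natural inductions

    -- An atom added to a stage of 𝒩 stays derivable once any stage of ℳ is
    -- joined to that stage.  The two accessibility arguments exchange places in
    -- the recursive call, as 𝒩 and ℳ do; one of them decreases.

    additions-persist :
      (𝒩 ℳ : NaturalInduction 𝔄) → Safe 𝒩 → Safe ℳ →
      let module N = NaturalInduction 𝒩
          module M = NaturalInduction ℳ in
      ∀ {α α′ β} → Acc N._<⁺_ α → Acc M._<⁺_ β → α′ N.IsSuccessorOf α →
      ∀ {A} → A ∈ N.stage α′ ∖ N.stage α → N.stage α ∪ M.stage β ⊢ A
    additions-persist 𝒩 ℳ safeᴺ safeᴹ {α} {_} {β} accα (acc below-β) suc A∈ =
      ⊢-resp-≐ (lim-adjoin ℳ β (start⊆stage 𝒩 α) derivable)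
        (proj₂ (safeᴺ suc A∈) (adjoin ℳ β (start⊆stage 𝒩 α) derivable))
      where
      module N = NaturalInduction 𝒩
      module M = NaturalInduction ℳ
      derivable : AdditionsDerivableWith (N.stage α) ℳ β
      derivable δ<β suc′ B∈ = ⊢-resp-≐ (Sum.swap , Sum.swap)
        (additions-persist ℳ 𝒩 safeᴹ safeᴺ (below-β δ<β) accα suc′ B∈)

    stage⊆limit-of-terminal :
      (𝒩 ℳ : NaturalInduction 𝔄) → Safe 𝒩 → SafeTerminal ℳ →
      ∀ α → NaturalInduction.stage 𝒩 α ⊆ lim ℳ
    stage⊆limit-of-terminal 𝒩 ℳ safeᴺ (safeᴹ , terminalᴹ) α =
      go (<⁺-wellFounded N.length α)
      where
      module N = NaturalInduction 𝒩
      module M = NaturalInduction ℳ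

      -- The atoms added to a stage included in lim ℳ are safely derivable
      -- from lim ℳ.

      addition : ∀ {γ α} → α N.IsSuccessorOf γ → N.stage γ ⊆ lim ℳ →
                 N.stage α ∖ N.stage γ ⊆ SafelyDerivable (lim ℳ)
      addition {γ} suc γ⊆lim A∈ =
        ⊢-resp-≐ absorb
          (additions-persist 𝒩 ℳ safeᴺ safeᴹ
            (<⁺-wellFounded N.length γ) (<⁺-wellFounded M.length ⊤⁺) suc A∈) ,
        λ 𝒦 → proj₂ (safeᴺ suc A∈)
          (concatenate (adjoin ℳ ⊤⁺ (start⊆stage 𝒩 γ) derivable) 𝒦
            (≐-trans (lim-adjoin ℳ ⊤⁺ (start⊆stage 𝒩 γ) derivable) absorb))
        where
        absorb : (N.stage γ ∪ lim ℳ) ≐ lim ℳ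
        absorb = Sum.[ γ⊆lim , id ] , inj₂

        derivable : AdditionsDerivableWith (N.stage γ) ℳ ⊤⁺
        derivable {δ} _ suc′ B∈ = ⊢-resp-≐ (Sum.swap , Sum.swap)
          (additions-persist ℳ 𝒩 safeᴹ safeᴺ
            (<⁺-wellFounded M.length δ) (<⁺-wellFounded N.length γ) suc′ B∈)

      go : ∀ {α} → Acc N._<⁺_ α → N.stage α ⊆ lim ℳ
      go {α} (acc below-α) {A} A∈ with em {P = N.IsZero α}
      ... | yes zero = start⊆stage ℳ ⊤⁺ (proj₁ (N.initial zero) A∈)
      ... | no ¬zero with em {P = ∃[ γ ] α N.IsSuccessorOf γ}
      ...   | no ¬suc with γ , γ<α , A∈γ ← proj₁ (N.limit (¬zero , ¬suc)) A∈ =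
        go (below-α γ<α) A∈γ
      ...   | yes (γ , suc) with em {P = A ∈ N.stage γ}
      ...     | yes A∈γ = go (below-α (proj₁ suc)) A∈γ
      ...     | no  A∉γ =
        terminalᴹ (addition suc (go (below-α (proj₁ suc))) (A∈ , A∉γ))

theorem4p9 : ∀ {ℓ} → ExcludedMiddle ℓ →
    (V : Vocabulary ℓ) (Δ : Syntax.FormalDefinition V)
    (𝒪 : Syntax.ContextStructure V Δ) → let open Induction V Δ 𝒪 in
    (𝒩 ℳ : NaturalInduction ∅) → SafeTerminal 𝒩 → SafeTerminal ℳ →
    lim 𝒩 ≐ lim ℳ
theorem4p9 em V Δ 𝒪 𝒩 ℳ stᴺ stᴹ =
  stage⊆limit-of-terminal V Δ 𝒪 em 𝒩 ℳ (proj₁ stᴺ) stᴹ ⊤⁺ ,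
  stage⊆limit-of-terminal V Δ 𝒪 em ℳ 𝒩 (proj₁ stᴹ) stᴺ ⊤⁺
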